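{- Let $A$ be a commutative ring, $k\ge1$, and $\vec s=(n_1,\dots,n_k)$ a tuple of positive integers. Then the diagonal simplicial tensor module $X_\bullet(\vec s;A)$ is contractible.
   Context: Notation: $[p]=\{0,\dots,p\}$. For a shape $\vec s=(n_1,\dots,n_k)$ put $n=\min(n_1,\dots,n_k)-1$, $M_a(p)=n_a-1-n+p$ (so $M_a(p)\ge p$) and $I_p=\prod_{a=1}^k[M_a(p)]$ for $p\ge 0$. Let $\delta_i^q:[q-1]\to[q]$ be the increasing injection missing $i$ and $\sigma_i^q:[q+1]\to[q]$ the nondecreasing surjection taking the value $i$ twice. Define $\Delta_i^p=\prod_{a=1}^k\delta_i^{M_a(p)}:I_{p-1}\to I_p$ ($p\ge1$, $0\le i\le p$) and $\Sigma_i^p=\prod_{a=1}^k\sigma_i^{M_a(p)}:I_{p+1}\to I_p$ ($p\ge 0$, $0\le i\le p$). The diagonal simplicial tensor module $X_\bullet(\vec s;A)$ is the simplicial $A$-module with $X_p=A^{I_p}$ (all functions $T:I_p\to A$), faces $d_i^p(T)=T\circ\Delta_i^p$ and degeneracies $s_i^p(T)=T\circ\Sigma_i^p$. Its associated unaugmented chain complex has $X_p$ in degree $p\ge0$, $X_p=0$ for $p<0$, $\partial_0=0$, and $\partial_p=\sum_{i=0}^p(-1)^id_i^p$ for $p\ge1$. "Contractible" means that this chain complex admits a chain contraction: $A$-linear maps $H_p:X_p\to X_{p+1}$ for $p\ge-1$ (with $H_{ -1}=0$) such that $\partial_{p+1}H_p+H_{p-1}\partial_p=\operatorname{id}_{X_p}$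 for all $p\ge0$. -}

module Defs where

open import Algebra.Bundles using (CommutativeRing)
import Algebra.Construct.Pointwise as Pointwise
open import Algebra.Module.Bundles using (Module)
import Algebra.Module.Construct.Zero as Zero
open import Algebra.Module.Morphism.Structures using (module ModuleMorphisms)
open import Algebra.Properties.CommutativeMonoid.Sum using (sum; sum-cong-≋; sum-replicate-zero; ∑-distrib-+)
open import Algebra.Properties.Semiring.Exp using (_^_)
open import Data.Fin.Base using (Fin; zero; suc; toℕ; inject₁; punchIn; pinch; _↑ˡ_)
open import Data.Fin.Properties using (toℕ-↑ˡ; toℕ-inject₁)
open import Data.Nat.Base as ℕ using (ℕ; zero; suc; _∸_; _⊓_; _≤_; _<_; z≤n; s≤s)
open import Data.Product.Base using (_,_)
open import Data.Vec.Base using (Vec; foldr₁)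
open import Data.Vec.Relation.Unary.All as All using (All; []; _∷_)
open import Level using (Level; _⊔_) renaming (suc to lsuc)
open import Relation.Binary.PropositionalEquality.Core using (_≡_; refl; sym; trans; cong; cong₂; subst₂)
import Relation.Binary.Reasoning.Setoid as ≈-Reasoning

module _ {c ℓ} {A : CommutativeRing c ℓ} where

  open CommutativeRing A using (Carrier; 0#; 1#; semiring)
    renaming (_+_ to _+ᴬ_; _*_ to _*ᴬ_; -_ to -ᴬ_)
  private module A = CommutativeRing A

  record LinearMap {m₁ ℓ₁ m₂ ℓ₂} (M : Module A m₁ ℓ₁) (N : Module A m₂ ℓ₂)
                   : Set (c ⊔ m₁ ⊔ ℓ₁ ⊔ m₂ ⊔ ℓ₂) where
    private
      module M = Module M
      module N = Module N
    open ModuleMorphisms M.rawModule N.rawModule using (IsModuleHomomorphism)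
    field
      ⟦_⟧                  : M.Carrierᴹ → N.Carrierᴹ
      isModuleHomomorphism : IsModuleHomomorphism ⟦_⟧
    open IsModuleHomomorphism isModuleHomomorphism public

  open LinearMap using (⟦_⟧)

  mkLinear : ∀ {m₁ ℓ₁ m₂ ℓ₂} (M : Module A m₁ ℓ₁) (N : Module A m₂ ℓ₂) →
             let module M = Module M
                 module N = Module N in
             (f : M.Carrierᴹ → N.Carrierᴹ) →
             (∀ {x y} → x M.≈ᴹ y → f x N.≈ᴹ f y) →
             (∀ x y → f (x M.+ᴹ y) N.≈ᴹ f x N.+ᴹ f y) →
             (∀ r x → f (r M.*ₗ x) N.≈ᴹ r N.*ₗ f x) →
             LinearMap M N
  mkLinear M N f f-cong f-+ f-* = record
    { ⟦_⟧ = f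
    ; isModuleHomomorphism = record
      { isBimoduleHomomorphism = record
        { +ᴹ-isGroupHomomorphism = record
          { isMonoidHomomorphism = record
            { isMagmaHomomorphism = record
              { isRelHomomorphism = record { cong = f-cong }
              ; homo = f-+
              }
            ; ε-homo = f-0
            }
          ; ⁻¹-homo = λ x → NP.inverseˡ-uniqueᴹ _ _
              (N.≈ᴹ-trans (N.≈ᴹ-sym (f-+ _ _))
                (N.≈ᴹ-trans (f-cong (M.-ᴹ‿inverseˡ x)) f-0))
          }
        ; *ₗ-homo = f-*
        ; *ᵣ-homo = λ r x →
            N.≈ᴹ-trans (f-cong (M.≈ᴹ-sym (M.*ₗ-*ᵣ-coincident r x)))
              (N.≈ᴹ-trans (f-* r x) (N.*ₗ-*ᵣ-coincident r (f x)))
        }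
      }
    }
    where
    module M = Module M
    module N = Module N
    import Algebra.Module.Properties as Prop
    module NP = Prop N
    f-0 : f M.0ᴹ N.≈ᴹ N.0ᴹ
    f-0 = N.≈ᴹ-trans (f-cong (M.≈ᴹ-sym (M.*ₗ-zeroˡ M.0ᴹ)))
            (N.≈ᴹ-trans (f-* 0# M.0ᴹ) (N.*ₗ-zeroˡ _))

  zeroMap : ∀ {m₁ ℓ₁ m₂ ℓ₂} (M : Module A m₁ ℓ₁) (N : Module A m₂ ℓ₂) → LinearMap M N
  zeroMap M N = mkLinear M N (λ _ → N.0ᴹ) (λ _ → N.≈ᴹ-refl)
    (λ _ _ → N.≈ᴹ-sym (N.+ᴹ-identityˡ _)) (λ r _ → N.≈ᴹ-sym (N.*ₗ-zeroʳ r))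
    where module N = Module N

-- Chain complexes concentrated in degrees p ≥ 0.

record ChainComplex {c ℓ} (A : CommutativeRing c ℓ) m ℓm : Set (c ⊔ ℓ ⊔ lsuc (m ⊔ ℓm)) where
  field
    X : ℕ → Module A m ℓm
    -- ∂ p is the boundary ∂_{p+1} : X_{p+1} → X_p.
    ∂ : ∀ p → LinearMap (X (suc p)) (X p)
  module X (p : ℕ) = Module (X p)
  field
    ∂∂≈0 : ∀ p x → X._≈ᴹ_ p (LinearMap.⟦_⟧ (∂ p) (LinearMap.⟦_⟧ (∂ (suc p)) x)) (X.0ᴹ p)

  -- The same complex with X_{-1} = 0 and ∂_0 = 0 made explicit, indices being
  -- shifted by one: X⁺ q = X_{q-1} and ∂⁺ p = ∂_p : X_p → X_{p-1}.
  X⁺ : ℕ → Module A m ℓm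
  X⁺ zero    = Zero.⟨module⟩
  X⁺ (suc p) = X p

  ∂⁺ : ∀ p → LinearMap (X⁺ (suc p)) (X⁺ p)
  ∂⁺ zero    = zeroMap (X 0) Zero.⟨module⟩
  ∂⁺ (suc p) = ∂ p

record Contraction {c ℓ m ℓm} {A : CommutativeRing c ℓ} (C : ChainComplex A m ℓm)
                   : Set (c ⊔ m ⊔ ℓm) where
  open ChainComplex C
  open LinearMap using (⟦_⟧)
  field
    -- H q is the map H_{q-1} : X_{q-1} → X_q, for q - 1 ≥ -1.
    H     : ∀ q → LinearMap (X⁺ q) (X⁺ (suc q))
    H₋₁≈0 : ∀ x → X._≈ᴹ_ 0 (⟦ H 0 ⟧ x) (X.0ᴹ 0)
    ∂H+H∂≈id : ∀ p x → let open Module (X p) in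
               ⟦ ∂⁺ (suc p) ⟧ (⟦ H (suc p) ⟧ x) +ᴹ ⟦ H p ⟧ (⟦ ∂⁺ p ⟧ x) ≈ᴹ x

record SimplicialModule {c ℓ} (A : CommutativeRing c ℓ) m ℓm : Set (c ⊔ ℓ ⊔ lsuc (m ⊔ ℓm)) where
  field
    X : ℕ → Module A m ℓm
    face       : ∀ {p} → Fin (suc (suc p)) → LinearMap (X (suc p)) (X p)
    degeneracy : ∀ {p} → Fin (suc p) → LinearMap (X p) (X (suc p))

  module X (p : ℕ) = Module (X p)

  d : ∀ {p} → Fin (suc (suc p)) → X.Carrierᴹ (suc p) → X.Carrierᴹ p
  d i = LinearMap.⟦_⟧ (face i)

  s : ∀ {p} → Fin (suc p) → X.Carrierᴹ p → X.Carrierᴹ (suc p)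
  s i = LinearMap.⟦_⟧ (degeneracy i)

  -- The usual simplicial identities, reindexed so that every index is a Fin
  -- without a predecessor: the strictly larger index is written suc _.
  field
    d-d : ∀ {p} (i j : Fin (suc (suc p))) x → toℕ i ≤ toℕ j →
          X._≈ᴹ_ p (d i (d (suc j) x)) (d j (d (inject₁ i) x))
    s-s : ∀ {p} (i j : Fin (suc p)) x → toℕ i ≤ toℕ j →
          X._≈ᴹ_ (suc (suc p)) (s (inject₁ i) (s j x)) (s (suc j) (s i x))
    d-s-< : ∀ {p} (i : Fin (suc (suc p))) (j : Fin (suc p)) x → toℕ i ≤ toℕ j →
            X._≈ᴹ_ (suc p) (d (inject₁ i) (s (suc j) x)) (s j (d i x))
    d-s-≡ : ∀ {p} (j : Fin (suc p)) x → X._≈ᴹ_ p (d (inject₁ j) (s j x)) x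
    d-s-suc : ∀ {p} (j : Fin (suc p)) x → X._≈ᴹ_ p (d (suc j) (s j x)) x
    d-s-> : ∀ {p} (i : Fin (suc (suc p))) (j : Fin (suc p)) x → toℕ j < toℕ i →
            X._≈ᴹ_ (suc p) (d (suc i) (s (inject₁ j) x)) (s j (d i x))

module _ {c ℓ m ℓm} {A : CommutativeRing c ℓ} (M : Module A m ℓm) where

  private
    module A = CommutativeRing A
  open Module M
  open ≈-Reasoning ≈ᴹ-setoid

  ∑ : ∀ {n} → (Fin n → Carrierᴹ) → Carrierᴹ
  ∑ = sum +ᴹ-commutativeMonoid

  private
    ∑-cong : ∀ {n} (f g : Fin n → Carrierᴹ) → (∀ i → f i ≈ᴹ g i) → ∑ f ≈ᴹ ∑ g
    ∑-cong f g = sum-cong-≋ +ᴹ-commutativeMonoid {x = f} {y = g}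

    ∑-+ : ∀ {n} (f g : Fin n → Carrierᴹ) → ∑ (λ i → f i +ᴹ g i) ≈ᴹ ∑ f +ᴹ ∑ g
    ∑-+ = ∑-distrib-+ +ᴹ-commutativeMonoid

    ∑-0 : ∀ {n} (f : Fin n → Carrierᴹ) → (∀ i → f i ≈ᴹ 0ᴹ) → ∑ f ≈ᴹ 0ᴹ
    ∑-0 {n} f f≈0 = ≈ᴹ-trans (∑-cong f (λ _ → 0ᴹ) f≈0) (sum-replicate-zero +ᴹ-commutativeMonoid n)

    ∑-* : ∀ {n} r (f : Fin n → Carrierᴹ) → ∑ (λ i → r *ₗ f i) ≈ᴹ r *ₗ ∑ f
    ∑-* {zero}  r f = ≈ᴹ-sym (*ₗ-zeroʳ r)
    ∑-* {suc n} r f = ≈ᴹ-trans (+ᴹ-congˡ (∑-* r (λ i → f (suc i)))) (≈ᴹ-sym (*ₗ-distribˡ r _ _))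

    ∑∑-cancel : ∀ n (f : Fin n → Fin (suc n) → Carrierᴹ) →
                (∀ i j → toℕ i ≤ toℕ j → f i (suc j) +ᴹ f j (inject₁ i) ≈ᴹ 0ᴹ) →
                ∑ (λ i → ∑ (f i)) ≈ᴹ 0ᴹ
    ∑∑-cancel zero    f h = ≈ᴹ-refl
    ∑∑-cancel (suc n) f h = begin
      (f zero zero +ᴹ row) +ᴹ ∑ (λ i → f (suc i) zero +ᴹ ∑ (λ j → f (suc i) (suc j)))
        ≈⟨ +ᴹ-cong (+ᴹ-comm _ _) (∑-+ (λ i → f (suc i) zero) (λ i → ∑ (λ j → f (suc i) (suc j)))) ⟩
      (row +ᴹ f zero zero) +ᴹ (col +ᴹ rest)
        ≈⟨ +ᴹ-assoc _ _ _ ⟩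
      row +ᴹ (f zero zero +ᴹ (col +ᴹ rest))
        ≈⟨ +ᴹ-congˡ (≈ᴹ-sym (+ᴹ-assoc _ _ _)) ⟩
      row +ᴹ (∑ (λ i → f i zero) +ᴹ rest)
        ≈⟨ ≈ᴹ-sym (+ᴹ-assoc _ _ _) ⟩
      (row +ᴹ ∑ (λ i → f i zero)) +ᴹ rest
        ≈⟨ +ᴹ-cong
             (≈ᴹ-trans (≈ᴹ-sym (∑-+ (λ j → f zero (suc j)) (λ i → f i zero)))
               (∑-0 (λ j → f zero (suc j) +ᴹ f j zero) (λ j → h zero j z≤n)))
             (∑∑-cancel n (λ i j → f (suc i) (suc j)) (λ i j i≤j → h (suc i) (suc j) (s≤s i≤j))) ⟩
      0ᴹ +ᴹ 0ᴹ
        ≈⟨ +ᴹ-identityˡ 0ᴹ ⟩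
      0ᴹ ∎
      where
      row  = ∑ (λ j → f zero (suc j))
      col  = ∑ (λ i → f (suc i) zero)
      rest = ∑ (λ i → ∑ (λ j → f (suc i) (suc j)))

  sign : ∀ {n} → Fin n → A.Carrier
  sign i = _^_ A.semiring (A.- A.1#) (toℕ i)

  alternatingSum : ∀ {n} → (Fin n → Carrierᴹ) → Carrierᴹ
  alternatingSum f = ∑ (λ i → sign i *ₗ f i)

  alternatingSum-cong : ∀ {n} (f g : Fin n → Carrierᴹ) →
                        (∀ i → f i ≈ᴹ g i) → alternatingSum f ≈ᴹ alternatingSum g
  alternatingSum-cong f g f≈g = ∑-cong _ (λ i → sign i *ₗ g i) (λ i → *ₗ-congˡ (f≈g i))

  alternatingSum-+ : ∀ {n} (f g : Fin n → Carrierᴹ) →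
                     alternatingSum (λ i → f i +ᴹ g i) ≈ᴹ alternatingSum f +ᴹ alternatingSum g
  alternatingSum-+ f g = ≈ᴹ-trans
    (∑-cong _ (λ i → sign i *ₗ f i +ᴹ sign i *ₗ g i) (λ i → *ₗ-distribˡ (sign i) (f i) (g i)))
    (∑-+ (λ i → sign i *ₗ f i) (λ i → sign i *ₗ g i))

  alternatingSum-* : ∀ {n} r (f : Fin n → Carrierᴹ) →
                     alternatingSum (λ i → r *ₗ f i) ≈ᴹ r *ₗ alternatingSum f
  alternatingSum-* r f = ≈ᴹ-trans
    (∑-cong _ (λ i → r *ₗ sign i *ₗ f i) (λ i → *ₗ-comm (sign i) r (f i)))
    (∑-* r (λ i → sign i *ₗ f i))

  alternatingSum²-cancel : ∀ n (f : Fin n → Fin (suc n) → Carrierᴹ) →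
                           (∀ i j → toℕ i ≤ toℕ j → f i (suc j) ≈ᴹ f j (inject₁ i)) →
                           alternatingSum (λ i → alternatingSum (f i)) ≈ᴹ 0ᴹ
  alternatingSum²-cancel n f h = ≈ᴹ-trans
    (∑-cong _ (λ i → ∑ (λ j → (sign i A.* sign j) *ₗ f i j)) (λ i → ≈ᴹ-trans
      (≈ᴹ-sym (∑-* (sign i) (λ j → sign j *ₗ f i j)))
      (∑-cong _ (λ j → (sign i A.* sign j) *ₗ f i j)
        (λ j → ≈ᴹ-sym (*ₗ-assoc (sign i) (sign j) (f i j))))))
    (∑∑-cancel n (λ i j → (sign i A.* sign j) *ₗ f i j) cancel)
    where
    cancel : ∀ i j → toℕ i ≤ toℕ j →
             (sign i A.* sign (suc j)) *ₗ f i (suc j) +ᴹ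
             (sign j A.* sign (inject₁ i)) *ₗ f j (inject₁ i) ≈ᴹ 0ᴹ
    cancel i j i≤j = begin
      (sign i A.* (A.- A.1# A.* sign j)) *ₗ f i (suc j) +ᴹ
        (sign j A.* sign (inject₁ i)) *ₗ y
        ≈⟨ +ᴹ-cong (*ₗ-cong left (h i j i≤j)) (*ₗ-congʳ right) ⟩
      (A.- A.1# A.* ε) *ₗ y +ᴹ (A.1# A.* ε) *ₗ y
        ≈⟨ ≈ᴹ-sym (*ₗ-distribʳ y _ _) ⟩
      (A.- A.1# A.* ε A.+ A.1# A.* ε) *ₗ y
        ≈⟨ *ₗ-congʳ (A.trans (A.sym (A.distribʳ ε _ _))
             (A.trans (A.*-congʳ (A.-‿inverseˡ A.1#)) (A.zeroˡ ε))) ⟩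
      A.0# *ₗ y
        ≈⟨ *ₗ-zeroˡ y ⟩
      0ᴹ ∎
      where
      y = f j (inject₁ i)
      ε = sign i A.* sign j
      left : sign i A.* (A.- A.1# A.* sign j) A.≈ A.- A.1# A.* ε
      left = A.trans (A.sym (A.*-assoc _ _ _))
               (A.trans (A.*-congʳ (A.*-comm _ _)) (A.*-assoc _ _ _))
      right : sign j A.* sign (inject₁ i) A.≈ A.1# A.* ε
      right = A.trans
        (A.*-congˡ (A.reflexive (cong (_^_ A.semiring (A.- A.1#)) (toℕ-inject₁ i))))
        (A.trans (A.*-comm _ _) (A.sym (A.*-identityˡ ε)))

module _ {c ℓ m ℓm} {A : CommutativeRing c ℓ} (S : SimplicialModule A m ℓm) where

  open SimplicialModule S

  unaugmentedChainComplex : ChainComplex A m ℓm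
  unaugmentedChainComplex = record
    { X = X
    ; ∂ = λ p → mkLinear (X (suc p)) (X p) (∂ p)
        (λ x≈y → alternatingSum-cong (X p) _ _ (λ i → LinearMap.⟦⟧-cong (face i) x≈y))
        (λ x y → X.≈ᴹ-trans p
          (alternatingSum-cong (X p) _ (λ i → X._+ᴹ_ p (d i x) (d i y)) (λ i → LinearMap.+ᴹ-homo (face i) x y))
          (alternatingSum-+ (X p) (λ i → d i x) (λ i → d i y)))
        (λ r x → X.≈ᴹ-trans p
          (alternatingSum-cong (X p) _ (λ i → X._*ₗ_ p r (d i x)) (λ i → LinearMap.*ₗ-homo (face i) r x))
          (alternatingSum-* (X p) r (λ i → d i x)))
    ; ∂∂≈0 = λ p x → X.≈ᴹ-trans p
        (alternatingSum-cong (X p) _ (λ i → alternatingSum (X p) (λ j → d i (d j x)))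
          (λ i → d-alternatingSum (face i) (λ j → d j x)))
        (alternatingSum²-cancel (X p) (suc (suc p)) (λ i j → d i (d j x))
          (λ i j i≤j → d-d i j x i≤j))
    }
    where
    ∂ : ∀ p → X.Carrierᴹ (suc p) → X.Carrierᴹ p
    ∂ p x = alternatingSum (X p) {suc (suc p)} (λ i → d i x)

    d-alternatingSum : ∀ {p q n} (f : LinearMap (X p) (X q)) (g : Fin n → X.Carrierᴹ p) →
      X._≈ᴹ_ q (LinearMap.⟦_⟧ f (alternatingSum (X p) g))
               (alternatingSum (X q) (λ i → LinearMap.⟦_⟧ f (g i)))
    d-alternatingSum {p} {q} f g = go (λ i → X._*ₗ_ p (sign (X p) i) (g i))
                                      (λ i → X._*ₗ_ q (sign (X q) i) (LinearMap.⟦_⟧ f (g i)))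
                                      (λ i → LinearMap.*ₗ-homo f (sign (X p) i) (g i))
      where
      go : ∀ {n} (u : Fin n → X.Carrierᴹ p) (v : Fin n → X.Carrierᴹ q) →
           (∀ i → X._≈ᴹ_ q (LinearMap.⟦_⟧ f (u i)) (v i)) →
           X._≈ᴹ_ q (LinearMap.⟦_⟧ f (∑ (X p) u)) (∑ (X q) v)
      go {zero}  u v h = LinearMap.0ᴹ-homo f
      go {suc n} u v h = X.≈ᴹ-trans q (LinearMap.+ᴹ-homo f _ _)
        (X.+ᴹ-cong q (h zero) (go (λ i → u (suc i)) (λ i → v (suc i)) (λ i → h (suc i))))

  Contractible : Set (c ⊔ m ⊔ ℓm)
  Contractible = Contraction unaugmentedChainComplex

power : ∀ {c ℓ} (A : CommutativeRing c ℓ) → Set → Module A c ℓ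
power A I = record
  { Carrierᴹ = I → Carrier
  ; _≈ᴹ_ = λ S T → ∀ x → S x ≈ T x
  ; _+ᴹ_ = λ S T x → S x + T x
  ; _*ₗ_ = λ r T x → r * T x
  ; _*ᵣ_ = λ T r x → T x * r
  ; 0ᴹ = λ _ → 0#
  ; -ᴹ_ = λ T x → - T x
  ; isModule = record
    { isBimodule = record
      { isBisemimodule = record
        { +ᴹ-isCommutativeMonoid = Pointwise.isCommutativeMonoid I +-isCommutativeMonoid
        ; isPreleftSemimodule = record
          { *ₗ-cong      = λ r≈s S≈T x → *-cong r≈s (S≈T x)
          ; *ₗ-zeroˡ     = λ T x → zeroˡ (T x)
          ; *ₗ-distribʳ  = λ T r s x → distribʳ (T x) r s
          ; *ₗ-identityˡ = λ T x → *-identityˡ (T x)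
          ; *ₗ-assoc     = λ r s T x → *-assoc r s (T x)
          ; *ₗ-zeroʳ     = λ r x → zeroʳ r
          ; *ₗ-distribˡ  = λ r S T x → distribˡ r (S x) (T x)
          }
        ; isPrerightSemimodule = record
          { *ᵣ-cong      = λ S≈T r≈s x → *-cong (S≈T x) r≈s
          ; *ᵣ-zeroʳ     = λ T x → zeroʳ (T x)
          ; *ᵣ-distribˡ  = λ T r s x → distribˡ (T x) r s
          ; *ᵣ-identityʳ = λ T x → *-identityʳ (T x)
          ; *ᵣ-assoc     = λ T r s x → *-assoc (T x) r s
          ; *ᵣ-zeroˡ     = λ r x → zeroˡ r
          ; *ᵣ-distribʳ  = λ r S T x → distribʳ r (S x) (T x)
          }
        ; *ₗ-*ᵣ-assoc = λ r T s x → *-assoc r (T x) s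
        }
      ; -ᴹ‿cong = λ S≈T x → -‿cong (S≈T x)
      ; -ᴹ‿inverse = (λ T x → -‿inverseˡ (T x)) , (λ T x → -‿inverseʳ (T x))
      }
    ; *ₗ-*ᵣ-coincident = λ r T x → *-comm r (T x)
    }
  }
  where open CommutativeRing A

precompose : ∀ {c ℓ} (A : CommutativeRing c ℓ) {I J : Set} →
             (I → J) → LinearMap (power A J) (power A I)
precompose A {I} {J} f = mkLinear (power A J) (power A I) (λ T x → T (f x))
  (λ S≈T x → S≈T (f x)) (λ _ _ _ → A.refl) (λ _ _ _ → A.refl)
  where module A = CommutativeRing A

private

  δδ : ∀ {n} (i j : Fin (suc n)) x → toℕ i ≤ toℕ j →
       punchIn (suc j) (punchIn i x) ≡ punchIn (inject₁ i) (punchIn j x)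
  δδ zero    j       x       _         = refl
  δδ (suc i) (suc j) zero    _         = refl
  δδ (suc i) (suc j) (suc x) (s≤s i≤j) = cong suc (δδ i j x i≤j)

  σσ : ∀ {n} (i j : Fin n) x → toℕ i ≤ toℕ j →
       pinch j (pinch (inject₁ i) x) ≡ pinch i (pinch (suc j) x)
  σσ zero    zero    zero          _ = refl
  σσ zero    (suc j) zero          _ = refl
  σσ zero    zero    (suc x)       _ = refl
  σσ zero    (suc j) (suc x)       _ = refl
  σσ (suc i) (suc j) zero          _ = refl
  σσ (suc i) (suc j) (suc x) (s≤s i≤j) = cong suc (σσ i j x i≤j)

  σδ-< : ∀ {n} (i : Fin (suc n)) (j : Fin n) x → toℕ i ≤ toℕ j →
         pinch (suc j) (punchIn (inject₁ i) x) ≡ punchIn i (pinch j x)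
  σδ-< zero    j       x       _         = refl
  σδ-< (suc i) (suc j) zero    _         = refl
  σδ-< (suc i) (suc j) (suc x) (s≤s i≤j) = cong suc (σδ-< i j x i≤j)

  σδ-≡ : ∀ {n} (j : Fin n) x → pinch j (punchIn (inject₁ j) x) ≡ x
  σδ-≡ zero    x       = refl
  σδ-≡ (suc j) zero    = refl
  σδ-≡ (suc j) (suc x) = cong suc (σδ-≡ j x)

  σδ-suc : ∀ {n} (j : Fin n) x → pinch j (punchIn (suc j) x) ≡ x
  σδ-suc zero    zero    = refl
  σδ-suc zero    (suc x) = refl
  σδ-suc (suc j) zero    = refl
  σδ-suc (suc j) (suc x) = cong suc (σδ-suc j x)

  σδ-> : ∀ {n} (i : Fin (suc n)) (j : Fin n) x → toℕ j < toℕ i →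
         pinch (inject₁ j) (punchIn (suc i) x) ≡ punchIn i (pinch j x)
  σδ-> (suc i) zero    zero    _         = refl
  σδ-> (suc i) zero    (suc x) _         = refl
  σδ-> (suc i) (suc j) zero    _         = refl
  σδ-> (suc i) (suc j) (suc x) (s≤s j<i) = cong suc (σδ-> i j x j<i)

  inject₁-↑ˡ : ∀ {n} (i : Fin n) r → inject₁ i ↑ˡ r ≡ inject₁ (i ↑ˡ r)
  inject₁-↑ˡ zero    r = refl
  inject₁-↑ˡ (suc i) r = cong suc (inject₁-↑ˡ i r)

  ↑ˡ-≤ : ∀ {m n} (i : Fin m) (j : Fin n) r → toℕ i ≤ toℕ j → toℕ (i ↑ˡ r) ≤ toℕ (j ↑ˡ r)
  ↑ˡ-≤ i j r = subst₂ _≤_ (sym (toℕ-↑ˡ i r)) (sym (toℕ-↑ˡ j r))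

  ↑ˡ-< : ∀ {m n} (i : Fin m) (j : Fin n) r → toℕ i < toℕ j → toℕ (i ↑ˡ r) < toℕ (j ↑ˡ r)
  ↑ˡ-< i j r = subst₂ _<_ (sym (toℕ-↑ˡ i r)) (sym (toℕ-↑ˡ j r))

  map-square : ∀ {P Q Q′ R : ℕ → Set} {k} {f : ∀ {a} → P a → Q a} {g : ∀ {a} → Q a → R a}
                 {f′ : ∀ {a} → P a → Q′ a} {g′ : ∀ {a} → Q′ a → R a} {v : Vec ℕ k} →
               (∀ {a} (x : P a) → g (f x) ≡ g′ (f′ x)) →
               (xs : All P v) →
               All.map {P = Q} {Q = R} g (All.map f xs) ≡ All.map {P = Q′} g′ (All.map f′ xs)
  map-square h []       = refl
  map-square h (x ∷ xs) = cong₂ _∷_ (h x) (map-square h xs)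

  map-retract : ∀ {P Q : ℕ → Set} {k} {f : ∀ {a} → P a → Q a} {g : ∀ {a} → Q a → P a} {v : Vec ℕ k} →
                (∀ {a} (x : P a) → g (f x) ≡ x) →
                (xs : All P v) → All.map {P = Q} {Q = P} g (All.map f xs) ≡ xs
  map-retract h []       = refl
  map-retract h (x ∷ xs) = cong₂ _∷_ (h x) (map-retract h xs)

module Diagonal {k : ℕ} (shape : Vec ℕ (suc k)) where

  n : ℕ
  n = foldr₁ _⊓_ shape ∸ 1

  -- M nₐ p is M_a(p) = nₐ - 1 - n + p. For entries nₐ ≥ 1 of the shape both
  -- truncated subtractions are exact. The summand p comes first so that
  -- M nₐ (suc p) reduces to suc (M nₐ p).
  excess : ℕ → ℕ
  excess nₐ = nₐ ∸ 1 ∸ n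

  M : ℕ → ℕ → ℕ
  M nₐ p = p ℕ.+ excess nₐ

  -- [q] = {0,…,q} is Fin (suc q). The product over a is a tuple with one
  -- component for each entry nₐ of the shape, so that equality in I p is _≡_.
  I : ℕ → Set
  I p = All (λ nₐ → Fin (suc (M nₐ p))) shape

  -- punchIn i is the increasing injection missing i and pinch i the
  -- nondecreasing surjection taking the value i twice; _↑ˡ_ regards i ≤ p as an
  -- element of [M_a(p)] with the same value.
  Δ : ∀ {p} → Fin (suc (suc p)) → I p → I (suc p)
  Δ i = All.map (λ {nₐ} → punchIn (i ↑ˡ excess nₐ))

  Σ : ∀ {p} → Fin (suc p) → I (suc p) → I p
  Σ i = All.map (λ {nₐ} → pinch (i ↑ˡ excess nₐ))

diagonalTensorModule : ∀ {c ℓ} (A : CommutativeRing c ℓ) {k} → Vec ℕ (suc k) → SimplicialModule A c ℓ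
diagonalTensorModule A shape = record
  { X          = λ p → power A (I p)
  ; face       = λ i → precompose A (Δ i)
  ; degeneracy = λ i → precompose A (Σ i)
  ; d-d = λ i j T i≤j x → A.reflexive (cong T (map-square
      (λ {a} y → trans (δδ (i ↑ˡ e a) (j ↑ˡ e a) y (↑ˡ-≤ i j (e a) i≤j))
        (cong (λ h → punchIn h (punchIn (j ↑ˡ e a) y)) (sym (inject₁-↑ˡ i (e a))))) x))
  ; s-s = λ i j T i≤j x → A.reflexive (cong T (map-square
      (λ {a} y → trans (cong (λ h → pinch (j ↑ˡ e a) (pinch h y)) (inject₁-↑ˡ i (e a)))
        (σσ (i ↑ˡ e a) (j ↑ˡ e a) y (↑ˡ-≤ i j (e a) i≤j))) x))
  ; d-s-< = λ i j T i≤j x → A.reflexive (cong T (map-square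
      (λ {a} y → trans (cong (λ h → pinch (suc j ↑ˡ e a) (punchIn h y)) (inject₁-↑ˡ i (e a)))
        (σδ-< (i ↑ˡ e a) (j ↑ˡ e a) y (↑ˡ-≤ i j (e a) i≤j))) x))
  ; d-s-≡ = λ j T x → A.reflexive (cong T (map-retract
      (λ {a} y → trans (cong (λ h → pinch (j ↑ˡ e a) (punchIn h y)) (inject₁-↑ˡ j (e a)))
        (σδ-≡ (j ↑ˡ e a) y)) x))
  ; d-s-suc = λ j T x → A.reflexive (cong T (map-retract
      (λ {a} y → σδ-suc (j ↑ˡ e a) y) x))
  ; d-s-> = λ i j T j<i x → A.reflexive (cong T (map-square
      (λ {a} y → trans (cong (λ h → pinch h (punchIn (suc i ↑ˡ e a) y)) (inject₁-↑ˡ j (e a)))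
        (σδ-> (i ↑ˡ e a) (j ↑ˡ e a) y (↑ˡ-< j i (e a) j<i))) x))
  }
  where
  open Diagonal shape renaming (excess to e)
  module A = CommutativeRing A

{-# OPTIONS --safe #-}

-- An extra degeneracy contracts the complex: extend T by zero along the shift
-- x ↦ x + 1 of all coordinates. Then d₀ H = id and dᵢ₊₁ H = H dᵢ, which
-- telescopes to ∂H + H∂ = id in degrees p ≥ 1. In degree 0 the remaining term
-- d₁ H T vanishes at every x with a zero coordinate, and every x ∈ I₀ has one:
-- if nₐ is minimal, then [Mₐ(0)] = {0}.
module Submission where

open import Defs
open import Algebra.Bundles using (CommutativeRing)
open import Algebra.Module.Bundles using (Module)
import Algebra.Module.Construct.Zero as Zero
open import Algebra.Properties.CommutativeMonoid.Sum using (sum-cong-≋)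
open import Data.Fin.Base using (Fin; zero; suc; punchIn; _↑ˡ_)
open import Data.Fin.Properties using (¬Fin0)
open import Data.Maybe.Base as Maybe using (Maybe; just; nothing; maybe′)
open import Data.Nat.Base using (ℕ; zero; suc; _∸_; _⊓_; NonZero)
open import Data.Nat.Properties using (⊓-sel; n∸n≡0)
open import Data.Product.Base using (_,_)
open import Data.Sum.Base using (inj₁; inj₂)
open import Data.Vec.Base using (Vec; []; _∷_; foldr₁)
open import Data.Vec.Relation.Unary.All as All using (All; []; _∷_)
open import Data.Vec.Relation.Unary.Any as Any using (Any; here; there)
open import Relation.Binary.PropositionalEquality using (_≡_; refl; sym; trans; cong; subst)
import Relation.Binary.Reasoning.Setoid as ≈-Reasoning
open import Relation.Nullary.Negation using (¬_; contradiction)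

open LinearMap using (⟦_⟧; ⟦⟧-cong; +ᴹ-homo; *ₗ-homo; 0ᴹ-homo)

module _ {c ℓ m ℓm} {A : CommutativeRing c ℓ} (M : Module A m ℓm) where

  private
    module A = CommutativeRing A
  open Module M

  -- By definition `sign (suc i)` is `- 1# * sign i`, so `- 1#` can be pulled out of the tail. It
  -- stays a scalar so that distributivity can later cancel it against `1#`.
  alternatingSum-suc : ∀ {n} (f : Fin (suc n) → Carrierᴹ) →
    alternatingSum M f ≈ᴹ
    f zero +ᴹ A.- A.1# *ₗ alternatingSum M (λ i → f (suc i))
  alternatingSum-suc f = +ᴹ-cong (*ₗ-identityˡ (f zero))
    (≈ᴹ-trans
      (sum-cong-≋ +ᴹ-commutativeMonoid
        {y = λ i → sign M i *ₗ (A.- A.1# *ₗ f (suc i))}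
        (λ i → ≈ᴹ-trans (*ₗ-congʳ (A.*-comm (A.- A.1#) (sign M i)))
                 (*ₗ-assoc (sign M i) (A.- A.1#) (f (suc i)))))
      (alternatingSum-* M (A.- A.1#) (λ i → f (suc i))))

module _ {c ℓ m₁ ℓ₁ m₂ ℓ₂} {A : CommutativeRing c ℓ}
         {M : Module A m₁ ℓ₁} {N : Module A m₂ ℓ₂} (f : LinearMap M N) where

  private
    module M = Module M
    module N = Module N

  -- Turns the termwise relation between `h` and the faces into one between `h` and the boundary.
  linear-alternatingSum : ∀ {n} (g : Fin n → M.Carrierᴹ) →
    ⟦ f ⟧ (alternatingSum M g) N.≈ᴹ alternatingSum N (λ i → ⟦ f ⟧ (g i))
  linear-alternatingSum g =
    N.≈ᴹ-trans (linear-∑ (λ i → sign M i M.*ₗ g i))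
      (sum-cong-≋ N.+ᴹ-commutativeMonoid
        {y = λ i → sign N i N.*ₗ ⟦ f ⟧ (g i)} (λ i → *ₗ-homo f (sign M i) (g i)))
    where
    linear-∑ : ∀ {n} (u : Fin n → M.Carrierᴹ) →
               ⟦ f ⟧ (∑ M u) N.≈ᴹ ∑ N (λ i → ⟦ f ⟧ (u i))
    linear-∑ {zero}  u = 0ᴹ-homo f
    linear-∑ {suc n} u = N.≈ᴹ-trans (+ᴹ-homo f _ _)
      (N.+ᴹ-congˡ (linear-∑ (λ i → u (suc i))))

module _ {c ℓ m ℓm} {A : CommutativeRing c ℓ} (S : SimplicialModule A m ℓm) where

  open SimplicialModule S
  private
    module A = CommutativeRing A

  -- In an augmented object, d₁h₀ would factor through degree -1. That module is zero here, whence
  -- the last hypothesis.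
  extraDegeneracy⇒contractible :
    (h : ∀ p → LinearMap (X p) (X (suc p))) →
    (∀ p x → X._≈ᴹ_ p (d zero (⟦ h p ⟧ x)) x) →
    (∀ p i x → X._≈ᴹ_ (suc p) (d (suc i) (⟦ h (suc p) ⟧ x)) (⟦ h p ⟧ (d i x))) →
    (∀ x → X._≈ᴹ_ 0 (d (suc zero) (⟦ h 0 ⟧ x)) (X.0ᴹ 0)) →
    Contractible S
  extraDegeneracy⇒contractible h d₀h d₊h d₁h₀ = record
    { H        = H
    ; H₋₁≈0    = λ _ → X.≈ᴹ-refl 0
    ; ∂H+H∂≈id = ∂H+H∂≈id
    }
    where
    open ChainComplex (unaugmentedChainComplex S) using (X⁺; ∂⁺)

    H : ∀ q → LinearMap (X⁺ q) (X⁺ (suc q))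
    H zero    = zeroMap Zero.⟨module⟩ (X 0)
    H (suc p) = h p

    ∂H+H∂≈id : ∀ p x → let open Module (X p) in
               ⟦ ∂⁺ (suc p) ⟧ (⟦ H (suc p) ⟧ x) +ᴹ ⟦ H p ⟧ (⟦ ∂⁺ p ⟧ x) ≈ᴹ x
    ∂H+H∂≈id zero x = begin
      alternatingSum (X 0) {2} (λ i → d i (⟦ h 0 ⟧ x)) +ᴹ 0ᴹ
        ≈⟨ +ᴹ-identityʳ _ ⟩
      alternatingSum (X 0) {2} (λ i → d i (⟦ h 0 ⟧ x))
        -- The sum unfolds to the d₀ term, the d₁ term and a trailing `0ᴹ` from the empty sum.
        ≈⟨ +ᴹ-cong (≈ᴹ-trans (*ₗ-identityˡ _) (d₀h 0 x))
             (≈ᴹ-trans (+ᴹ-identityʳ _) (≈ᴹ-trans (*ₗ-congˡ (d₁h₀ x)) (*ₗ-zeroʳ _))) ⟩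
      x +ᴹ 0ᴹ
        ≈⟨ +ᴹ-identityʳ x ⟩
      x ∎
      where
      open Module (X 0)
      open ≈-Reasoning ≈ᴹ-setoid
    ∂H+H∂≈id (suc p) x = begin
      alternatingSum (X (suc p)) (λ i → d i (⟦ h (suc p) ⟧ x)) +ᴹ ⟦ h p ⟧ ∂x
        ≈⟨ +ᴹ-cong (alternatingSum-suc (X (suc p)) (λ i → d i (⟦ h (suc p) ⟧ x)))
             (≈ᴹ-sym (*ₗ-identityˡ _)) ⟩
      (d zero (⟦ h (suc p) ⟧ x) +ᴹ A.- A.1# *ₗ tail) +ᴹ A.1# *ₗ ⟦ h p ⟧ ∂x
        ≈⟨ +ᴹ-congʳ (+ᴹ-cong (d₀h (suc p) x) (*ₗ-congˡ tail≈h∂x)) ⟩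
      (x +ᴹ A.- A.1# *ₗ ⟦ h p ⟧ ∂x) +ᴹ A.1# *ₗ ⟦ h p ⟧ ∂x
        ≈⟨ +ᴹ-assoc _ _ _ ⟩
      x +ᴹ (A.- A.1# *ₗ ⟦ h p ⟧ ∂x +ᴹ A.1# *ₗ ⟦ h p ⟧ ∂x)
        ≈⟨ +ᴹ-congˡ (*ₗ-distribʳ _ _ _) ⟨
      x +ᴹ (A.- A.1# A.+ A.1#) *ₗ ⟦ h p ⟧ ∂x
        ≈⟨ +ᴹ-congˡ (≈ᴹ-trans (*ₗ-congʳ (A.-‿inverseˡ A.1#)) (*ₗ-zeroˡ _)) ⟩
      x +ᴹ 0ᴹ
        ≈⟨ +ᴹ-identityʳ x ⟩
      x ∎
      where
      open Module (X (suc p))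
      open ≈-Reasoning ≈ᴹ-setoid
      ∂x   = alternatingSum (X p) (λ i → d i x)
      tail = alternatingSum (X (suc p)) (λ i → d (suc i) (⟦ h (suc p) ⟧ x))
      tail≈h∂x : tail ≈ᴹ ⟦ h p ⟧ ∂x
      tail≈h∂x = ≈ᴹ-trans
        (alternatingSum-cong (X (suc p)) _ (λ i → ⟦ h p ⟧ (d i x)) (λ i → d₊h p i x))
        (≈ᴹ-sym (linear-alternatingSum (h p) (λ i → d i x)))

module _ {c ℓ} (A : CommutativeRing c ℓ) {I J : Set} where

  private
    module A = CommutativeRing A

  -- `Maybe` encodes a partial map. If it is the partial inverse of an injection, the result is
  -- extension by zero along that injection.
  extendByZero : (I → Maybe J) → LinearMap (power A J) (power A I)
  extendByZero f = mkLinear (power A J) (power A I) (λ T x → maybe′ T A.0# (f x))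
    (λ S≈T x → cong′ S≈T (f x)) (λ S T x → +-homo S T (f x)) (λ r T x → *-homo r T (f x))
    where
    cong′ : ∀ {S T} → (∀ y → S y A.≈ T y) → ∀ z → maybe′ S A.0# z A.≈ maybe′ T A.0# z
    cong′ S≈T (just y) = S≈T y
    cong′ S≈T nothing  = A.refl
    +-homo : ∀ S T z → maybe′ (λ y → S y A.+ T y) A.0# z A.≈ maybe′ S A.0# z A.+ maybe′ T A.0# z
    +-homo S T (just y) = A.refl
    +-homo S T nothing  = A.sym (A.+-identityˡ A.0#)
    *-homo : ∀ r T z → maybe′ (λ y → r A.* T y) A.0# z A.≈ r A.* maybe′ T A.0# z
    *-homo r T (just y) = A.refl
    *-homo r T nothing  = A.sym (A.zeroʳ r)

module _ {P : ℕ → ℕ} where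

  -- The partial inverse of the shift `All.map suc`: a single zero coordinate makes it undefined.
  -- `P a` may be 0, which occurs in degree 0.
  predecessor : ∀ {k} {v : Vec ℕ k} →
                All (λ a → Fin (suc (P a))) v → Maybe (All (λ a → Fin (P a)) v)
  predecessor []           = just []
  predecessor (zero  ∷ xs) = nothing
  predecessor (suc x ∷ xs) = Maybe.map (x ∷_) (predecessor xs)

  -- Gives d₀h = id, because `punchIn zero` reduces to `suc`.
  predecessor-suc : ∀ {k} {v : Vec ℕ k} (xs : All (λ a → Fin (P a)) v) →
                    predecessor (All.map suc xs) ≡ just xs
  predecessor-suc []       = refl
  predecessor-suc (x ∷ xs) rewrite predecessor-suc xs = refl

-- `punchIn (suc i)` fixes `zero` and sends `suc x` to `suc (punchIn i x)`, so it neither creates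
-- nor removes zero coordinates. The index depends on `a` because each coordinate has its own `Fin`.
predecessor-punchIn : ∀ {P : ℕ → ℕ} (i : ∀ a → Fin (suc (P a))) {k} {v : Vec ℕ k}
  (xs : All (λ a → Fin (suc (P a))) v) →
  predecessor {λ a → suc (P a)} (All.map (λ {a} → punchIn (suc (i a))) xs) ≡
  Maybe.map (All.map (λ {a} → punchIn (i a))) (predecessor xs)
predecessor-punchIn i []           = refl
predecessor-punchIn i (zero  ∷ xs) = refl
predecessor-punchIn i (suc x ∷ xs) rewrite predecessor-punchIn i xs
  with predecessor xs
... | just _  = refl
... | nothing = refl

-- The `Any` proof also locates the component of a tuple that belongs to the minimal entry.
minimum-attained : ∀ {k} (v : Vec ℕ (suc k)) → Any (_≡ foldr₁ _⊓_ v) v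
minimum-attained (x ∷ [])     = here refl
minimum-attained (x ∷ y ∷ ys) with ⊓-sel x (foldr₁ _⊓_ (y ∷ ys))
... | inj₁ eq = here (sym eq)
... | inj₂ eq = there (Any.map (λ z≡ → trans z≡ (sym eq)) (minimum-attained (y ∷ ys)))

mainTheorem5 : ∀ {c ℓ} (A : CommutativeRing c ℓ) (k : ℕ) (shape : Vec ℕ (suc k)) →
    All NonZero shape → Contractible (diagonalTensorModule A shape)
mainTheorem5 A k shape _ = extraDegeneracy⇒contractible (diagonalTensorModule A shape)
  (λ p → extendByZero A (predecessor {λ a → suc (M a p)}))
  (λ p T x → A.reflexive (cong (maybe′ T A.0#) (predecessor-suc x)))
  (λ p i T x → A.trans
    (A.reflexive (cong (maybe′ T A.0#) (predecessor-punchIn (λ a → i ↑ˡ excess a) x)))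
    (maybe-map (Δ i) T (predecessor x)))
  -- Here `P` is `excess`, since `M a 0` reduces to `excess a`. The predecessor of a point of `I 0`
  -- would thus have coordinates in `Fin (excess a)`.
  (λ T x → A.trans
    (A.reflexive (cong (maybe′ T A.0#) (predecessor-punchIn (λ _ → zero) x)))
    (vanishes T (predecessor x)))
  where
  open Diagonal shape
  module A = CommutativeRing A

  maybe-map : ∀ {I J : Set} (f : I → J) (T : J → A.Carrier) z →
              maybe′ T A.0# (Maybe.map f z) A.≈ maybe′ (λ y → T (f y)) A.0# z
  maybe-map f T (just y) = A.refl
  maybe-map f T nothing  = A.refl

  -- At a minimal entry `excess` becomes `n ∸ n`, which is 0, so that component would lie in
  -- `Fin 0`.
  empty : ¬ All (λ a → Fin (excess a)) shape
  empty ys with All.lookupAny ys (minimum-attained shape)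
  ... | y , nₐ≡min =
    ¬Fin0 (subst Fin (trans (cong (λ a → a ∸ 1 ∸ n) nₐ≡min) (n∸n≡0 n)) y)

  vanishes : ∀ T (z : Maybe (All (λ a → Fin (excess a)) shape)) →
             maybe′ T A.0# (Maybe.map (All.map (punchIn zero)) z) A.≈ A.0#
  vanishes T (just ys) = contradiction ys empty
  vanishes T nothing   = A.refl
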